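{- Let $\alpha=\alpha_1\alpha_2\ldots$ be an infinite binary word containing infinitely many $1$s. Then the clique-width of graphs in the class $\mathcal{G}_\alpha$ is unbounded, i.e. there is no constant $c$ such that every graph in $\mathcal{G}_\alpha$ has clique-width at most $c$.
   Context: Graphs are undirected, without loops or multiple edges. The clique-width of a finite graph $G$ is the minimum number of labels needed to construct $G$ by an expression using the following operations: creation of a new vertex with label $i$; disjoint union of two labelled graphs; $\eta_{i,j}$ ($i\neq j$), adding all edges between vertices labelled $i$ and vertices labelled $j$; $\rho_{i\to j}$, renaming label $i$ to label $j$. Let $\mathbb{N}=\{1,2,\ldots\}$. The graph $\mathcal{P}$ has vertex set $\{v_{i,j}: i,j\in\mathbb{N}\}$ and edge set $\{\{v_{i,j},v_{i,j+1}\}: i,j\in\mathbb{N}\}$. Its $j$th column is $V_j=\{v_{i,j}: i\in\mathbb{N}\}$. For an infinite binary word $\alpha$ (each $\alpha_j\in\{0,1\}$), the graph $\mathcal{P}^\alpha$ is obtained from $\mathcal{P}$ by complementing the edges between $V_j$ and $V_{j+1}$ for exactly those $j$ with $\alpha_j=1$; that is, the only edges are between consecutive columns, and $v_{i,j}$ is adjacent to $v_{k,j+1}$ iff ($\alpha_j=0$ and $i=k$) or ($\alpha_j=1$ and $i\neq k$). The class $\mathcal{G}_\alpha$ consists of all finite induced subgraphs of $\mathcal{P}^\alpha$ (up to isomorphism). -}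

module Defs where

open import Level using (0ℓ)
open import Data.Digit using (Bit; 0b; 1b)
open import Data.Empty using (⊥)
open import Data.Fin using (Fin; _≟_)
open import Data.Nat using (ℕ; suc; _≤_)
open import Data.Nat.Properties using (1+n≢n)
open import Data.Product using (Σ-syntax; ∃-syntax; _×_; _,_; proj₁)
open import Data.Sum using (_⊎_; inj₁; inj₂; [_,_]′; swap)
open import Data.Sum.Relation.Binary.Pointwise
  using (Pointwise; inj₁; inj₂; ⊎-symmetric)
open import Data.Unit using (⊤)
open import Data.Bool using (if_then_else_)
open import Function using (_↔_; _↣_; _⇔_; Inverse; Injection)
open import Relation.Binary using (Rel; Symmetric; Irreflexive)
open import Relation.Binary.PropositionalEquality
  using (_≡_; _≢_; refl; sym; trans)
open import Relation.Nullary using (does)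

record Graph : Set₁ where
  field
    Vertex : Set
    Adj    : Rel Vertex 0ℓ
    symm   : Symmetric Adj
    irrefl : Irreflexive _≡_ Adj

open Graph

Finite : Graph → Set
Finite G = ∃[ n ] (Vertex G ↔ Fin n)

infix 4 _≅_ _↪_

_≅_ : Graph → Graph → Set
G ≅ H = Σ[ f ∈ Vertex G ↔ Vertex H ]
  (∀ u v → Adj G u v ⇔ Adj H (Inverse.to f u) (Inverse.to f v))

-- G is isomorphic to an induced subgraph of H.
_↪_ : Graph → Graph → Set
G ↪ H = Σ[ f ∈ Vertex G ↣ Vertex H ]
  (∀ u v → Adj G u v ⇔ Adj H (Injection.to f u) (Injection.to f v))

record LabelledGraph (k : ℕ) : Set₁ where
  field
    graph : Graph
    label : Vertex graph → Fin k

open LabelledGraph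

infixr 6 _⊕_

data Expr (k : ℕ) : Set where
  vertex : Fin k → Expr k
  _⊕_    : Expr k → Expr k → Expr k
  η      : (i j : Fin k) → i ≢ j → Expr k → Expr k
  ρ      : (i j : Fin k) → Expr k → Expr k

singleton : ∀ {k} → Fin k → LabelledGraph k
singleton i = record
  { graph = record
    { Vertex = ⊤
    ; Adj    = λ _ _ → ⊥
    ; symm   = λ ()
    ; irrefl = λ _ ()
    }
  ; label = λ _ → i
  }

disjointUnion : ∀ {k} → LabelledGraph k → LabelledGraph k → LabelledGraph k
disjointUnion G H = record
  { graph = record
    { Vertex = Vertex (graph G) ⊎ Vertex (graph H)
    ; Adj    = Pointwise (Adj (graph G)) (Adj (graph H))
    ; symm   = ⊎-symmetric (symm (graph G)) (symm (graph H))
    ; irrefl = λ where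
        refl (inj₁ e) → irrefl (graph G) refl e
        refl (inj₂ e) → irrefl (graph H) refl e
    }
  ; label = [ label G , label H ]′
  }

join : ∀ {k} (i j : Fin k) → i ≢ j → LabelledGraph k → LabelledGraph k
join i j i≢j G = record
  { graph = record
    { Vertex = Vertex (graph G)
    ; Adj    = λ u v → Adj (graph G) u v ⊎ (New u v ⊎ New v u)
    ; symm   = λ where
        (inj₁ e) → inj₁ (symm (graph G) e)
        (inj₂ e) → inj₂ (swap e)
    ; irrefl = λ where
        refl (inj₁ e)        → irrefl (graph G) refl e
        refl (inj₂ (inj₁ e)) → new-irrefl e
        refl (inj₂ (inj₂ e)) → new-irrefl e
    }
  ; label = label G
  }
  where
  New : Rel (Vertex (graph G)) 0ℓ
  New u v = label G u ≡ i × label G v ≡ j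

  new-irrefl : ∀ {u} → New u u → ⊥
  new-irrefl (p , q) = i≢j (trans (sym p) q)

relabel : ∀ {k} (i j : Fin k) → LabelledGraph k → LabelledGraph k
relabel i j G = record
  { graph = graph G
  ; label = λ v → if does (label G v ≟ i) then j else label G v
  }

⟦_⟧ : ∀ {k} → Expr k → LabelledGraph k
⟦ vertex i ⟧    = singleton i
⟦ e₁ ⊕ e₂ ⟧     = disjointUnion ⟦ e₁ ⟧ ⟦ e₂ ⟧
⟦ η i j i≢j e ⟧ = join i j i≢j ⟦ e ⟧
⟦ ρ i j e ⟧     = relabel i j ⟦ e ⟧

Constructible : ℕ → Graph → Set
Constructible k G = Σ[ e ∈ Expr k ] (graph ⟦ e ⟧ ≅ G)

-- The graph without vertices is the value of no expression, so no k is its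
-- clique-width.
HasCliqueWidth : Graph → ℕ → Set
HasCliqueWidth G k = Constructible k G × (∀ l → Constructible l G → k ≤ l)

-- Rows, columns and the letters of α are numbered from 0, and (i , j) is the
-- vertex in row i of column j.  Forward α u v says that v lies in the column
-- following that of u and is joined to u.
Forward : (ℕ → Bit) → Rel (ℕ × ℕ) 0ℓ
Forward α (i , j) (k , l) =
  l ≡ suc j × ((α j ≡ 0b × i ≡ k) ⊎ (α j ≡ 1b × i ≢ k))

𝒫^ : (ℕ → Bit) → Graph
𝒫^ α = record
  { Vertex = ℕ × ℕ
  ; Adj    = λ u v → Forward α u v ⊎ Forward α v u
  ; symm   = swap
  ; irrefl = λ where
      refl (inj₁ e) → 1+n≢n (sym (proj₁ e))
      refl (inj₂ e) → 1+n≢n (sym (proj₁ e))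
  }

𝒢 : (ℕ → Bit) → Graph → Set
𝒢 α G = Finite G × G ↪ 𝒫^ α

-- "Every graph in C has clique-width at most c" quantifies over all k with
-- HasCliqueWidth G k.  Asking instead for such a k ≤ c would make the bound
-- fail, for trivial reasons, on the graph without vertices.
BoundedCliqueWidth : (Graph → Set) → Set₁
BoundedCliqueWidth C =
  ∃[ c ] (∀ G → C G → ∀ k → HasCliqueWidth G k → k ≤ c)

{-# OPTIONS --safe #-}
-- The label classes of a subexpression with vertex set S consist of vertices with
-- equal neighbourhoods outside S.  Take the subgraph of 𝒫^ α on rows < n and
-- columns ≤ M, where n is large compared with M and there are more than c ones
-- among the first M letters of α, and suppose that it has an expression with
-- k ≤ c labels.  Choose S so that column 0 has more than M * k vertices inside
-- S and more than M * k outside.  If a row starts in S but leaves it, record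
-- the column and the label of its first exit: two rows with the same record
-- would contradict the equality of neighbourhoods, so some row a lies wholly in
-- S; likewise some row b lies wholly outside.  At ones p < q of α, the vertices
-- (a , p) and (a , q) are distinguished by (b , q + 1), so there are more than
-- c labels.
module Submission where

open import Defs
open import Data.Bool using (if_then_else_)
open import Data.Digit using (Bit; 0b; 1b)
open import Data.Empty using (⊥-elim)
open import Data.Fin as Fin using (Fin; zero; suc; toℕ; inject₁; inject≤; combine)
open import Data.Fin.Properties as Fin using (*↔×; pigeonhole; combine-injective; toℕ-injective; toℕ-inject₁; toℕ<n)
open import Data.List using (List; []; _∷_; length; map; filter; allFin; lookup; cartesianProduct; partitionSums)
open import Data.List.Membership.Propositional using (_∈_)
open import Data.List.Membership.Propositional.Properties using (∈-lookup; ∈-map⁺; ∈-allFin; ∈-cartesianProduct⁺)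
open import Data.List.Properties using (filter-all; length-map; length-tabulate)
open import Data.List.Relation.Unary.All as All using (All; []; _∷_)
import Data.List.Relation.Unary.All.Properties as All
open import Data.List.Relation.Unary.AllPairs using ([]; _∷_)
open import Data.List.Relation.Unary.Any using (here; there)
open import Data.List.Relation.Unary.Unique.Propositional using (Unique)
import Data.List.Relation.Unary.Unique.Propositional.Properties as Unique
open import Data.Maybe using (Maybe; just; nothing)
open import Data.Maybe.Properties using (just-injective)
open import Data.Nat using (ℕ; zero; suc; _+_; _*_; _≤_; _<_; z≤n; s≤s)
import Data.Nat as ℕ
open import Data.Nat.Induction using (<-rec)
open import Data.Nat.InfinitelyOften using (Inf)
open import Data.Nat.Properties hiding (_≟_)
open import Data.Product using (Σ-syntax; ∃; ∃-syntax; _×_; _,_; proj₁; proj₂)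
open import Data.Product.Properties using (,-injectiveˡ; ,-injectiveʳ)
open import Data.Sum using (_⊎_; inj₁; inj₂; [_,_]′)
open import Data.Sum.Function.Propositional using (_⊎-↔_)
open import Data.Sum.Relation.Binary.Pointwise using (inj₁; inj₂)
open import Data.Unit using (tt)
open import Function using (_∘_; id; _↔_; mk⇔; mk↣; Inverse; Injection; Equivalence; Injective)
open import Function.Properties.Inverse using (↔-sym; ↔-trans; ↔⇒↣)
open import Relation.Binary.PropositionalEquality using (_≡_; _≢_; refl; sym; trans; cong; cong₂; subst; subst₂)
open import Relation.Nullary using (¬_; Dec; yes; no; does; contradiction)
open import Relation.Nullary.Decidable using (_×-dec_; _⊎-dec_; ¬?)
import Relation.Binary as B
import Relation.Unary as U

open Graph
open LabelledGraph

-- Pigeonhole on lists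

lookup-injective : ∀ {A : Set} {xs : List A} → Unique xs →
  ∀ i j → lookup xs i ≡ lookup xs j → i ≡ j
lookup-injective (x∉ ∷ u) zero    zero    eq = refl
lookup-injective (x∉ ∷ u) zero    (suc j) eq = contradiction eq (All.lookup x∉ (∈-lookup j))
lookup-injective (x∉ ∷ u) (suc i) zero    eq = contradiction (sym eq) (All.lookup x∉ (∈-lookup i))
lookup-injective (x∉ ∷ u) (suc i) (suc j) eq = cong suc (lookup-injective u i j eq)

-- `Q` is a relation because one element may fit several holes; it is enough that no hole fits two
-- elements. Two positions with a common hole then carry the same element, which `Unique` forbids.
pigeonhole-all : ∀ {A : Set} {m} {Q : A → Fin m → Set} →
  (∀ {x y i} → Q x i → Q y i → x ≡ y) →
  ∀ {xs} → Unique xs → m < length xs → ¬ All (λ x → ∃ (Q x)) xs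
pigeonhole-all {Q = Q} inj {xs} u m< all =
  let hole = λ i → All.lookup all (∈-lookup {xs = xs} i)
      i , j , i<j , eq = pigeonhole m< (λ i → proj₁ (hole i))
  in <⇒≢ i<j (cong toℕ (lookup-injective u i j
       (inj (proj₂ (hole i)) (subst (Q (lookup xs j)) (sym eq) (proj₂ (hole j))))))

partition-all : ∀ {A : Set} {P Q : A → Set} {xs} →
  All (λ x → P x ⊎ Q x) xs → All P xs ⊎ ∃ Q
partition-all []            = inj₁ []
partition-all (inj₂ q ∷ _)  = inj₂ (_ , q)
partition-all (inj₁ p ∷ as) with partition-all as
... | inj₁ ps = inj₁ (p ∷ ps)
... | inj₂ q  = inj₂ q

-- For rows, `Q` records a crossing of the cut and `P` says that the row never crosses. There are
-- too few records for every row to cross.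
pigeonhole-any : ∀ {A : Set} {m} {P : A → Set} {Q : A → Fin m → Set} →
  (∀ {x y i} → Q x i → Q y i → x ≡ y) →
  ∀ {xs} → Unique xs → m < length xs → All (λ x → ∃ (Q x) ⊎ P x) xs → ∃ P
pigeonhole-any inj u m< as with partition-all as
... | inj₁ qs = ⊥-elim (pigeonhole-all inj u m< qs)
... | inj₂ p  = p

length-filter-map : ∀ {A B : Set} {P : B → Set} (P? : U.Decidable P) (f : A → B) xs →
  length (filter P? (map f xs)) ≡ length (filter (P? ∘ f) xs)
length-filter-map P? f []       = refl
length-filter-map P? f (x ∷ xs) with P? (f x)
... | yes _ = cong suc (length-filter-map P? f xs)
... | no  _ = length-filter-map P? f xs

lefts : ∀ {A B : Set} → List (A ⊎ B) → List A
lefts = proj₁ ∘ partitionSums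

rights : ∀ {A B : Set} → List (A ⊎ B) → List B
rights = proj₂ ∘ partitionSums

length-lefts+rights : ∀ {A B : Set} (xs : List (A ⊎ B)) →
  length (lefts xs) + length (rights xs) ≡ length xs
length-lefts+rights []            = refl
length-lefts+rights (inj₁ _ ∷ xs) = cong suc (length-lefts+rights xs)
length-lefts+rights (inj₂ _ ∷ xs) = trans (+-suc _ _) (cong suc (length-lefts+rights xs))

lefts-all : ∀ {A B : Set} {P : A ⊎ B → Set} {xs} → All P xs → All (P ∘ inj₁) (lefts xs)
lefts-all {xs = []}         []       = []
lefts-all {xs = inj₁ _ ∷ _} (p ∷ ps) = p ∷ lefts-all ps
lefts-all {xs = inj₂ _ ∷ _} (_ ∷ ps) = lefts-all ps

rights-all : ∀ {A B : Set} {P : A ⊎ B → Set} {xs} → All P xs → All (P ∘ inj₂) (rights xs)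
rights-all {xs = []}         []       = []
rights-all {xs = inj₁ _ ∷ _} (_ ∷ ps) = rights-all ps
rights-all {xs = inj₂ _ ∷ _} (p ∷ ps) = p ∷ rights-all ps

lefts-unique : ∀ {A B : Set} {xs : List (A ⊎ B)} → Unique xs → Unique (lefts xs)
lefts-unique {xs = []}         []       = []
lefts-unique {xs = inj₁ _ ∷ _} (x∉ ∷ u) = All.map (_∘ cong inj₁) (lefts-all x∉) ∷ lefts-unique u
lefts-unique {xs = inj₂ _ ∷ _} (_ ∷ u)  = lefts-unique u

rights-unique : ∀ {A B : Set} {xs : List (A ⊎ B)} → Unique xs → Unique (rights xs)
rights-unique {xs = []}         []       = []
rights-unique {xs = inj₁ _ ∷ _} (_ ∷ u)  = rights-unique u
rights-unique {xs = inj₂ _ ∷ _} (x∉ ∷ u) = All.map (_∘ cong inj₂) (rights-all x∉) ∷ rights-unique u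

-- Cuts of an expression

Inside : ∀ {A : Set} → Maybe A → Set
Inside m = ∃[ a ] m ≡ just a

inside? : ∀ {A : Set} → U.Decidable (Inside {A})
inside? (just a) = yes (a , refl)
inside? nothing  = no λ ()

Outside : ∀ {A : Set} → Maybe A → Set
Outside m = m ≡ nothing

outside? : ∀ {A : Set} → U.Decidable (Outside {A})
outside? (just a) = no λ ()
outside? nothing  = yes refl

¬inside⇒outside : ∀ {A : Set} (m : Maybe A) → ¬ Inside m → Outside m
¬inside⇒outside (just a) ¬in = contradiction (a , refl) ¬in
¬inside⇒outside nothing  _   = refl

¬outside⇒inside : ∀ {A : Set} (m : Maybe A) → ¬ Outside m → Inside m
¬outside⇒inside (just a) _    = a , refl
¬outside⇒inside nothing  ¬out = contradiction refl ¬out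

inside outside : ∀ {A B : Set} → (A → Maybe B) → List A → List A
inside  part = filter (inside? ∘ part)
outside part = filter (outside? ∘ part)

length-inside+outside : ∀ {A B : Set} (part : A → Maybe B) xs →
  length (inside part xs) + length (outside part xs) ≡ length xs
length-inside+outside part []       = refl
length-inside+outside part (x ∷ xs) with part x
... | just _  = cong suc (length-inside+outside part xs)
... | nothing = trans (+-suc _ _) (cong suc (length-inside+outside part xs))

-- One implication suffices, since `u` and `v` can be exchanged.
Twins : ∀ {L : Set} (G : Graph) → (Vertex G → Maybe L) → Set
Twins G part = ∀ {l u v w} → part u ≡ just l → part v ≡ just l → Outside (part w) →
  Adj G u w → Adj G v w

-- part assigns to the vertices of a subexpression their labels there.
record Cut {k} (H : LabelledGraph k) : Set where
  field
    part      : Vertex (graph H) → Maybe (Fin k)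
    sameLabel : ∀ {l u v} → part u ≡ just l → part v ≡ just l → label H u ≡ label H v
    twins     : Twins (graph H) part

open Cut

whole : ∀ {k} (H : LabelledGraph k) → Cut H
whole H = record
  { part      = just ∘ label H
  ; sameLabel = λ p q → just-injective (trans p (sym q))
  ; twins     = λ _ _ ()
  }

whole-inside : ∀ {k} (H : LabelledGraph k) xs → inside (part (whole H)) xs ≡ xs
whole-inside H xs = filter-all _ (All.universal (λ _ → _ , refl) xs)

-- The other operand lies wholly outside. No edge runs between the operands, so it separates
-- nothing.
leftCut : ∀ {k} (H₁ H₂ : LabelledGraph k) → Cut H₁ → Cut (disjointUnion H₁ H₂)
leftCut H₁ H₂ c = record { part = p ; sameLabel = λ {_} {u} {v} → same {u = u} {v} ; twins = tw }
  where
  p : Vertex (graph H₁) ⊎ Vertex (graph H₂) → Maybe _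
  p = [ part c , (λ _ → nothing) ]′
  same : ∀ {l u v} → p u ≡ just l → p v ≡ just l →
    label (disjointUnion H₁ H₂) u ≡ label (disjointUnion H₁ H₂) v
  same {u = inj₁ _} {inj₁ _} = sameLabel c
  same {u = inj₁ _} {inj₂ _} _ ()
  same {u = inj₂ _} ()
  tw : Twins (graph (disjointUnion H₁ H₂)) p
  tw {v = inj₁ _} eu ev ew (inj₁ a) = inj₁ (twins c eu ev ew a)
  tw {v = inj₂ _} eu () ew (inj₁ a)

rightCut : ∀ {k} (H₁ H₂ : LabelledGraph k) → Cut H₂ → Cut (disjointUnion H₁ H₂)
rightCut H₁ H₂ c = record { part = p ; sameLabel = λ {_} {u} {v} → same {u = u} {v} ; twins = tw }
  where
  p : Vertex (graph H₁) ⊎ Vertex (graph H₂) → Maybe _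
  p = [ (λ _ → nothing) , part c ]′
  same : ∀ {l u v} → p u ≡ just l → p v ≡ just l →
    label (disjointUnion H₁ H₂) u ≡ label (disjointUnion H₁ H₂) v
  same {u = inj₂ _} {inj₂ _} = sameLabel c
  same {u = inj₂ _} {inj₁ _} _ ()
  same {u = inj₁ _} ()
  tw : Twins (graph (disjointUnion H₁ H₂)) p
  tw {v = inj₂ _} eu ev ew (inj₂ a) = inj₂ (twins c eu ev ew a)
  tw {v = inj₁ _} eu () ew (inj₂ a)

leftCut-inside : ∀ {k} (H₁ H₂ : LabelledGraph k) (c : Cut H₁) xs →
  length (inside (part (leftCut H₁ H₂ c)) xs) ≡ length (inside (part c) (lefts xs))
leftCut-inside H₁ H₂ c []            = refl
leftCut-inside H₁ H₂ c (inj₁ x ∷ xs) with part c x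
... | just _  = cong suc (leftCut-inside H₁ H₂ c xs)
... | nothing = leftCut-inside H₁ H₂ c xs
leftCut-inside H₁ H₂ c (inj₂ x ∷ xs) = leftCut-inside H₁ H₂ c xs

rightCut-inside : ∀ {k} (H₁ H₂ : LabelledGraph k) (c : Cut H₂) xs →
  length (inside (part (rightCut H₁ H₂ c)) xs) ≡ length (inside (part c) (rights xs))
rightCut-inside H₁ H₂ c []            = refl
rightCut-inside H₁ H₂ c (inj₁ x ∷ xs) = rightCut-inside H₁ H₂ c xs
rightCut-inside H₁ H₂ c (inj₂ x ∷ xs) with part c x
... | just _  = cong suc (rightCut-inside H₁ H₂ c xs)
... | nothing = rightCut-inside H₁ H₂ c xs

-- This is where `sameLabel` is needed: vertices of one class still agree in their current label, so
-- a join adds edges from an outside vertex to both or to neither.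
joinCut : ∀ {k} {i j : Fin k} {i≢j : i ≢ j} (H : LabelledGraph k) → Cut H → Cut (join i j i≢j H)
joinCut H c = record
  { part      = part c
  ; sameLabel = sameLabel c
  ; twins     = λ where
      eu ev ew (inj₁ a)               → inj₁ (twins c eu ev ew a)
      eu ev ew (inj₂ (inj₁ (lu , lw))) → inj₂ (inj₁ (trans (sameLabel c ev eu) lu , lw))
      eu ev ew (inj₂ (inj₂ (lw , lu))) → inj₂ (inj₂ (lw , trans (sameLabel c ev eu) lu))
  }

-- Renaming may give different classes the same current label but never splits a class; `part` keeps
-- the old labels.
relabelCut : ∀ {k} {i j : Fin k} (H : LabelledGraph k) → Cut H → Cut (relabel i j H)
relabelCut {i = i} {j} H c = record
  { part      = part c
  ; sameLabel = λ eu ev → cong (λ l → if does (l Fin.≟ i) then j else l) (sameLabel c eu ev)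
  ; twins     = twins c
  }

-- Descend into an operand as long as it holds more than `T` of the listed vertices. At a union
-- where neither operand does, the whole holds at most `T + T` and is the cut.
balanced-cut : ∀ {k} (e : Expr k) T → 1 ≤ T → ∀ xs → Unique xs → T < length xs →
  Σ[ c ∈ Cut ⟦ e ⟧ ] T < length (inside (part c) xs) × length (inside (part c) xs) ≤ T + T
balanced-cut (vertex i) T 1≤T []           _ ()
-- A leaf contributes at most one vertex to a list without repetitions, whereas `1 ≤ T` asks for
-- two.
balanced-cut (vertex i) T 1≤T (x ∷ [])     _ T< = contradiction 1≤T (<⇒≱ T<)
balanced-cut (vertex i) T 1≤T (x ∷ y ∷ xs) ((x≢y ∷ _) ∷ _) _ = contradiction refl x≢y
balanced-cut (e₁ ⊕ e₂) T 1≤T xs u T<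
  with T ℕ.<? length (lefts xs) | T ℕ.<? length (rights xs)
... | yes T<l | _ =
  let c , lo , hi = balanced-cut e₁ T 1≤T (lefts xs) (lefts-unique u) T<l
      eq = leftCut-inside ⟦ e₁ ⟧ ⟦ e₂ ⟧ c xs
  in leftCut ⟦ e₁ ⟧ ⟦ e₂ ⟧ c , subst (T <_) (sym eq) lo , subst (_≤ T + T) (sym eq) hi
... | no _ | yes T<r =
  let c , lo , hi = balanced-cut e₂ T 1≤T (rights xs) (rights-unique u) T<r
      eq = rightCut-inside ⟦ e₁ ⟧ ⟦ e₂ ⟧ c xs
  in rightCut ⟦ e₁ ⟧ ⟦ e₂ ⟧ c , subst (T <_) (sym eq) lo , subst (_≤ T + T) (sym eq) hi
... | no T≮l | no T≮r =
  let H  = ⟦ e₁ ⊕ e₂ ⟧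
      eq = cong length (whole-inside H xs)
  in whole H , subst (T <_) (sym eq) T< ,
     subst (_≤ T + T) (trans (length-lefts+rights xs) (sym eq)) (+-mono-≤ (≮⇒≥ T≮l) (≮⇒≥ T≮r))
balanced-cut (η i j i≢j e) T 1≤T xs u T< =
  let c , bounds = balanced-cut e T 1≤T xs u T< in joinCut ⟦ e ⟧ c , bounds
balanced-cut (ρ i j e) T 1≤T xs u T< =
  let c , bounds = balanced-cut e T 1≤T xs u T< in relabelCut ⟦ e ⟧ c , bounds

-- The grid subgraphs of 𝒫^ α

Link : Bit → ℕ → ℕ → Set
Link b i k = (b ≡ 0b × i ≡ k) ⊎ (b ≡ 1b × i ≢ k)

link? : ∀ b i k → Dec (Link b i k)
link? b i k = (b Fin.≟ 0b ×-dec i ℕ.≟ k) ⊎-dec (b Fin.≟ 1b ×-dec ¬? (i ℕ.≟ k))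

link-sym : ∀ {b i k} → Link b i k → Link b k i
link-sym (inj₁ (b , eq)) = inj₁ (b , sym eq)
link-sym (inj₂ (b , ne)) = inj₂ (b , ne ∘ sym)

-- Row `k` itself tells `i` and `k` apart: for letter 0 it is linked to `k` alone, for letter 1 to
-- every row except `k`.
link-separates : ∀ b {i k} → (Link b i k → Link b k k) → (Link b k k → Link b i k) → i ≡ k
link-separates zero _ g with g (inj₁ (refl , refl))
... | inj₁ (_ , eq) = eq
... | inj₂ (() , _)
link-separates (suc zero) {i} {k} f _ with i ℕ.≟ k
... | yes eq = eq
... | no  ne with f (inj₂ (refl , ne))
...   | inj₁ (() , _)
...   | inj₂ (_ , k≢k) = contradiction refl k≢k

adj? : ∀ α → B.Decidable (Adj (𝒫^ α))
adj? α (i , j) (k , l) =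
  (l ℕ.≟ suc j ×-dec link? (α j) i k) ⊎-dec (j ℕ.≟ suc l ×-dec link? (α l) k i)

module _ (α : ℕ → Bit) where

  adj⇒link : ∀ {i j k} → Adj (𝒫^ α) (i , j) (k , suc j) → Link (α j) i k
  adj⇒link (inj₁ (_ , l))  = l
  adj⇒link (inj₂ (eq , _)) = contradiction eq (<⇒≢ (m<n⇒m<1+n ≤-refl))

  position : ∀ {n m} → Fin n × Fin m → ℕ × ℕ
  position (i , j) = toℕ i , toℕ j

  position-injective : ∀ {n m} → Injective _≡_ _≡_ (position {n} {m})
  position-injective eq =
    cong₂ _,_ (toℕ-injective (,-injectiveˡ eq)) (toℕ-injective (,-injectiveʳ eq))

  grid : ℕ → ℕ → Graph
  grid n m = record
    { Vertex = Fin n × Fin m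
    ; Adj    = λ u v → Adj (𝒫^ α) (position u) (position v)
    ; symm   = symm (𝒫^ α)
    ; irrefl = λ where refl → irrefl (𝒫^ α) refl
    }

  grid-𝒢 : ∀ n m → 𝒢 α (grid n m)
  grid-𝒢 n m = (n * m , ↔-sym *↔×) , mk↣ position-injective , λ _ _ → mk⇔ id id

  module _ {n M : ℕ} where

    G : Graph
    G = grid n (suc M)

    step⇒link : ∀ {i k} (j : Fin M) → Adj G (i , inject₁ j) (k , suc j) →
      Link (α (toℕ j)) (toℕ i) (toℕ k)
    step⇒link j rewrite toℕ-inject₁ j = adj⇒link

    link⇒step : ∀ {i k} (j : Fin M) → Link (α (toℕ j)) (toℕ i) (toℕ k) →
      Adj G (i , inject₁ j) (k , suc j)
    link⇒step j l rewrite toℕ-inject₁ j = inj₁ (refl , l)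

    module _ {k} {part : Vertex G → Maybe (Fin k)} (tw : Twins G part) where

      -- The number `x` encodes the column and the label of the last vertex before leaving. The exit
      -- need not be the first one.
      Exit : Fin n → Fin (M * k) → Set
      Exit r x = ∃[ j ] ∃[ l ] x ≡ combine j l ×
        part (r , inject₁ j) ≡ just l × Outside (part (r , suc j))

      -- The vertices of both rows in column `j` are in one class, so the outside vertex of row `s`
      -- in the next column cannot separate them; `link-separates` forces the rows to coincide.
      exit-injective : ∀ {r s x} → Exit r x → Exit s x → r ≡ s
      exit-injective (j , l , refl , r∈ , r∉) (j′ , l′ , eq , s∈ , s∉)
        with refl , refl ← combine-injective j l j′ l′ eq =
        toℕ-injective (link-separates (α (toℕ j))
          (step⇒link j ∘ tw r∈ s∈ s∉ ∘ link⇒step j)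
          (step⇒link j ∘ tw s∈ r∈ s∉ ∘ link⇒step j))

      Entrance : Fin n → Fin (M * k) → Set
      Entrance r x = ∃[ j ] ∃[ l ] x ≡ combine j l ×
        Outside (part (r , inject₁ j)) × part (r , suc j) ≡ just l

      -- The mirror image of exits: the class now lies in column `j + 1` and the outside vertex in
      -- column `j`, so edges are reversed before and after `tw` is applied.
      entrance-injective : ∀ {r s x} → Entrance r x → Entrance s x → r ≡ s
      entrance-injective (j , l , refl , r∉ , r∈) (j′ , l′ , eq , s∉ , s∈)
        with refl , refl ← combine-injective j l j′ l′ eq =
        toℕ-injective (link-separates (α (toℕ j)) (back r∈ s∈ s∉) (back s∈ r∈ s∉))
        where
        back : ∀ {t u v l} → part (t , suc j) ≡ just l → part (u , suc j) ≡ just l →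
          Outside (part (v , inject₁ j)) →
          Link (α (toℕ j)) (toℕ t) (toℕ v) → Link (α (toℕ j)) (toℕ u) (toℕ v)
        back t∈ u∈ v∉ = link-sym ∘ step⇒link j ∘ symm G ∘
          tw t∈ u∈ v∉ ∘ symm G ∘ link⇒step j ∘ link-sym

      separated-rows : ∀ {N} → k < N → (p : Fin N → Fin M) → (∀ t → α (toℕ (p t)) ≡ 1b) →
        (∀ {s t} → s Fin.< t → p t Fin.< p s) →
        ∀ {a b} → (∀ j → Inside (part (a , j))) → ¬ (∀ j → Outside (part (b , j)))
      separated-rows k<N p one decr {a} {b} a∈ b∉
        with s , t , s<t , eq ← pigeonhole k<N (λ t → proj₁ (a∈ (inject₁ (p t))))
        -- The letter 1 at `p s` joins row `a` in that column to row `b` in the next. The twin in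
        -- the earlier column `p t` would have to be joined to the same vertex, but its column is
        -- too far away.
        with tw (proj₂ (a∈ (inject₁ (p s))))
                (trans (proj₂ (a∈ (inject₁ (p t)))) (cong just (sym eq)))
                (b∉ (suc (p s)))
                (link⇒step (p s) (inj₂ (one s , a≢b)))
        where
        a≢b : toℕ a ≢ toℕ b
        a≢b eq with refl ← toℕ-injective eq
          with () ← trans (sym (proj₂ (a∈ zero))) (b∉ zero)
      ... | inj₁ (eq′ , _) = <⇒≢ (decr s<t) (sym (trans (suc-injective eq′) (toℕ-inject₁ (p t))))
      ... | inj₂ (eq′ , _) = <⇒≢ (m<n⇒m<1+n (m<n⇒m<1+n (decr s<t)))
                               (trans (sym (toℕ-inject₁ (p t))) eq′)

-- Large grids have no expression with few labels

persists-or-stops : ∀ {M} {P : Fin (suc M) → Set} → U.Decidable P → P zero →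
  (∃[ j ] P (inject₁ j) × ¬ P (suc j)) ⊎ (∀ j → P j)
persists-or-stops {zero}  P? p = inj₂ λ where zero → p
persists-or-stops {suc M} P? p with P? (suc zero)
... | no ¬q = inj₁ (zero , p , ¬q)
... | yes q with persists-or-stops (P? ∘ suc) q
...   | inj₁ (j , r) = inj₁ (suc j , r)
...   | inj₂ all     = inj₂ λ where
  zero    → p
  (suc j) → all j

-- `T` exceeds the number `M * k` of possible crossings. It is defined from the bound `c`, since the
-- grid must be fixed before its clique-width `k` is known. With more than three times `T` rows,
-- both sides of a balanced cut meet column 0 in more than `T` vertices.
grid-not-constructible : ∀ α {k c N M n} → k ≤ c → k < N →
  (p : Fin N → Fin M) → (∀ t → α (toℕ (p t)) ≡ 1b) →
  (∀ {s t} → s Fin.< t → p t Fin.< p s) →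
  let T = suc (M * c) in T + (T + T) < n → ¬ Constructible k (grid α n (suc M))
grid-not-constructible α {k} {c} {N} {M} {n} k≤c k<N p one decr n> (e , φ , adj) =
  separated-rows α tw k<N p one decr (proj₂ fullRow) (proj₂ emptyRow)
  where
  T = suc (M * c)
  open Inverse φ using (to; from; strictlyInverseˡ)

  column₀ : Fin n → Vertex (graph ⟦ e ⟧)
  column₀ i = from (i , zero)

  column₀-injective : ∀ {i j} → column₀ i ≡ column₀ j → i ≡ j
  column₀-injective eq =
    cong proj₁ (trans (sym (strictlyInverseˡ _)) (trans (cong to eq) (strictlyInverseˡ _)))

  xs = map column₀ (allFin n)

  length-xs : length xs ≡ n
  length-xs = trans (length-map column₀ (allFin n)) (length-tabulate id)

  cut = balanced-cut e T (s≤s z≤n) xs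
    (Unique.map⁺ column₀-injective (Unique.allFin⁺ n))
    (subst (T <_) (sym length-xs) (≤-<-trans (m≤m+n T (T + T)) n>))

  q : Fin n × Fin (suc M) → Maybe (Fin k)
  q = part (proj₁ cut) ∘ from

  tw : Twins (grid α n (suc M)) q
  tw {u = u} {v} {w} eu ev ew a =
    subst₂ (Adj (grid α n (suc M))) (strictlyInverseˡ v) (strictlyInverseˡ w)
      (Equivalence.to (adj _ _) (twins (proj₁ cut) eu ev ew
        (Equivalence.from (adj _ _)
          (subst₂ (Adj (grid α n (suc M))) (sym (strictlyInverseˡ u)) (sym (strictlyInverseˡ w)) a))))

  starts : Fin n → Maybe (Fin k)
  starts i = q (i , zero)

  M*k<T : M * k < T
  M*k<T = s≤s (*-monoʳ-≤ M k≤c)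

  in≡ : length (inside (part (proj₁ cut)) xs) ≡ length (inside starts (allFin n))
  in≡ = length-filter-map (inside? ∘ part (proj₁ cut)) column₀ (allFin n)

  T<in : T < length (inside starts (allFin n))
  T<in = subst (T <_) in≡ (proj₁ (proj₂ cut))

  in≤2T : length (inside starts (allFin n)) ≤ T + T
  in≤2T = subst (_≤ T + T) in≡ (proj₂ (proj₂ cut))

  -- At most `T + T` of the more than `T + (T + T)` rows start inside.
  T<out : T < length (outside starts (allFin n))
  T<out = +-cancelˡ-< (length (inside starts (allFin n))) _ _ (begin-strict
    length (inside starts (allFin n)) + T  ≤⟨ +-monoˡ-≤ T in≤2T ⟩
    T + T + T                              ≡⟨ +-comm (T + T) T ⟩
    T + (T + T)                            <⟨ n> ⟩
    n                                      ≡⟨ length-tabulate id ⟨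
    length (allFin n)                      ≡⟨ length-inside+outside starts (allFin n) ⟨
    length (inside starts (allFin n)) + length (outside starts (allFin n)) ∎)
    where open ≤-Reasoning

  exit-or-full : ∀ {r} → Inside (starts r) → ∃ (Exit α tw r) ⊎ (∀ j → Inside (q (r , j)))
  exit-or-full {r} s with persists-or-stops (λ j → inside? (q (r , j))) s
  ... | inj₁ (j , (l , r∈) , r∉) =
          inj₁ (combine j l , j , l , refl , r∈ , ¬inside⇒outside _ r∉)
  ... | inj₂ full = inj₂ full

  entrance-or-empty : ∀ {r} → Outside (starts r) →
    ∃ (Entrance α tw r) ⊎ (∀ j → Outside (q (r , j)))
  entrance-or-empty {r} s with persists-or-stops (λ j → outside? (q (r , j))) s
  ... | inj₁ (j , r∉ , r∈) with l , eq ← ¬outside⇒inside _ r∈ =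
          inj₁ (combine j l , j , l , refl , r∉ , eq)
  ... | inj₂ empty = inj₂ empty

  fullRow : ∃[ a ] ∀ j → Inside (q (a , j))
  fullRow = pigeonhole-any (exit-injective α tw)
    (Unique.filter⁺ (inside? ∘ starts) (Unique.allFin⁺ n)) (<-trans M*k<T T<in)
    (All.map exit-or-full (All.all-filter (inside? ∘ starts) (allFin n)))

  emptyRow : ∃[ b ] ∀ j → Outside (q (b , j))
  emptyRow = pigeonhole-any (entrance-injective α tw)
    (Unique.filter⁺ (outside? ∘ starts) (Unique.allFin⁺ n)) (<-trans M*k<T T<out)
    (All.map entrance-or-empty (All.all-filter (outside? ∘ starts) (allFin n)))

-- Finite graphs have a clique-width

-- There are `suc m` vertices, as no expression builds the empty graph.
edgeless : ∀ m {k} → (Fin (suc m) → Fin k) → Expr k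
edgeless zero    f = vertex (f zero)
edgeless (suc m) f = vertex (f zero) ⊕ edgeless m (f ∘ suc)

edgeless-vertices : ∀ m {k} (f : Fin (suc m) → Fin k) →
  Vertex (graph ⟦ edgeless m f ⟧) ↔ Fin (suc m)
edgeless-vertices zero    f = ↔-sym Fin.1↔⊤
edgeless-vertices (suc m) f =
  ↔-trans (↔-sym Fin.1↔⊤ ⊎-↔ edgeless-vertices m (f ∘ suc)) (↔-sym Fin.+↔⊎)

edgeless-label : ∀ m {k} (f : Fin (suc m) → Fin k) v →
  label ⟦ edgeless m f ⟧ v ≡ f (Inverse.to (edgeless-vertices m f) v)
edgeless-label zero    f tt        = refl
edgeless-label (suc m) f (inj₁ tt) = refl
edgeless-label (suc m) f (inj₂ v)  = edgeless-label m (f ∘ suc) v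

edgeless-adj : ∀ m {k} (f : Fin (suc m) → Fin k) {u v} → ¬ Adj (graph ⟦ edgeless m f ⟧) u v
edgeless-adj zero    f ()
edgeless-adj (suc m) f (inj₁ ())
edgeless-adj (suc m) f (inj₂ a) = edgeless-adj m (f ∘ suc) a

module _ (G : Graph) {m} (code : Vertex G ↔ Fin (suc m)) (dec : B.Decidable (Adj G)) where

  private
    c = Inverse.to code
    V = Vertex G

    c-injective : ∀ {x y} → c x ≡ c y → x ≡ y
    c-injective = Injection.injective (↔⇒↣ code)

  -- A stage in drawing `G` edge by edge: every edge drawn belongs to `G`, but only pairs in `es`
  -- are sure to have been treated. Each vertex keeps its code as a private label.
  record Drawing (es : List (V × V)) : Set where
    field
      expr     : Expr (suc m)
      iso      : Vertex (graph ⟦ expr ⟧) ↔ V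
      labelled : ∀ u → label ⟦ expr ⟧ u ≡ c (Inverse.to iso u)
      sound    : ∀ {u v} → Adj (graph ⟦ expr ⟧) u v → Adj G (Inverse.to iso u) (Inverse.to iso v)
      complete : ∀ {u v} → (Inverse.to iso u , Inverse.to iso v) ∈ es →
        Adj G (Inverse.to iso u) (Inverse.to iso v) → Adj (graph ⟦ expr ⟧) u v

  open Drawing

  draw : ∀ es → Drawing es
  draw [] = record
    { expr     = edgeless m id
    ; iso      = ↔-trans (edgeless-vertices m id) (↔-sym code)
    ; labelled = λ u → trans (edgeless-label m id u) (sym (Inverse.strictlyInverseˡ code _))
    ; sound    = λ a → ⊥-elim (edgeless-adj m id a)
    ; complete = λ ()
    }
  draw ((x , y) ∷ es) with draw es | dec x y
  ... | d | no ¬a = record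
    { expr     = expr d
    ; iso      = iso d
    ; labelled = labelled d
    ; sound    = sound d
    ; complete = λ where
        (here eq) a → contradiction
          (subst₂ (Adj G) (,-injectiveˡ eq) (,-injectiveʳ eq) a) ¬a
        (there i) a → complete d i a
    }
  ... | d | yes a = record
    -- As labels are private, this join adds exactly the edge between `x` and `y`.
    { expr     = η (c x) (c y) (λ eq → irrefl G (c-injective eq) a) (expr d)
    ; iso      = iso d
    ; labelled = labelled d
    ; sound    = λ where
        (inj₁ b)              → sound d b
        (inj₂ (inj₁ (p , q))) → subst₂ (Adj G) (sym (vertex≡ p)) (sym (vertex≡ q)) a
        (inj₂ (inj₂ (p , q))) → symm G (subst₂ (Adj G) (sym (vertex≡ p)) (sym (vertex≡ q)) a)
    ; complete = λ where
        (here eq) b → inj₂ (inj₁ ( trans (labelled d _) (cong c (,-injectiveˡ eq))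
                                 , trans (labelled d _) (cong c (,-injectiveʳ eq))))
        (there i) b → inj₁ (complete d i b)
    }
    where
    vertex≡ : ∀ {u z} → label ⟦ expr d ⟧ u ≡ c z → Inverse.to (iso d) u ≡ z
    vertex≡ p = c-injective (trans (sym (labelled d _)) p)

  finite⇒constructible : Constructible (suc m) G
  finite⇒constructible = expr d , iso d ,
    λ u v → mk⇔ (sound d) (complete d (∈-cartesianProduct⁺ (∈-vertices _) (∈-vertices _)))
    where
    vertices : List V
    vertices = map (Inverse.from code) (allFin (suc m))

    ∈-vertices : ∀ v → v ∈ vertices
    ∈-vertices v = subst (_∈ vertices) (Inverse.strictlyInverseʳ code v)
      (∈-map⁺ (Inverse.from code) (∈-allFin (c v)))

    d = draw (cartesianProduct vertices vertices)

-- Strong induction replaces a search for the least `k`, since `Constructible` is not decided here.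
-- The double negation is harmless because the theorem is itself a negation.
constructible⇒¬¬cliqueWidth : ∀ G {k} → Constructible k G → ¬ ¬ ∃ (HasCliqueWidth G)
constructible⇒¬¬cliqueWidth G {k} con none =
  <-rec (λ k → ¬ Constructible k G)
    (λ k smaller con → none (k , con , λ l con′ → ≮⇒≥ λ l<k → smaller l<k con′))
    k con

-- Choosing the ones of the word, and the theorem

infinitely-many-ones : ∀ {P : ℕ → Set} → Inf P → ∀ N →
  ¬ ¬ (∃[ M ] Σ[ p ∈ (Fin N → Fin M) ]
    (∀ t → P (toℕ (p t))) × (∀ {s t} → s Fin.< t → p t Fin.< p s))
infinitely-many-ones inf zero    none = none (0 , (λ ()) , (λ ()) , λ { {()} })
infinitely-many-ones {P} inf (suc N) none =
  infinitely-many-ones inf N λ (M , p , Pp , decr) →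
  -- `Inf` only refutes a bound beyond which `P` fails, so `q` is available only while deriving a
  -- contradiction. All earlier positions lie below `M`; placing `q` at index zero keeps the
  -- enumeration decreasing.
  inf (M , λ q M≤q Pq →
    let p′ : Fin (suc N) → Fin (suc q)
        p′ = λ { zero → Fin.fromℕ q ; (suc t) → inject≤ (p t) (m≤n⇒m≤1+n M≤q) }
        small : ∀ t → toℕ (inject≤ (p t) (m≤n⇒m≤1+n M≤q)) ≡ toℕ (p t)
        small t = Fin.toℕ-inject≤ (p t) _
    in none (suc q , p′
      , (λ { zero    → subst P (sym (Fin.toℕ-fromℕ q)) Pq
           ; (suc t) → subst P (sym (small t)) (Pp t) })
      , λ { {zero}  {suc t} _         → subst₂ _<_ (sym (small t)) (sym (Fin.toℕ-fromℕ q))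
                                          (<-≤-trans (toℕ<n (p t)) M≤q)
          ; {suc s} {suc t} (s≤s s<t) → subst₂ _<_ (sym (small t)) (sym (small s)) (decr s<t) }))

lemma2 : (α : ℕ → Bit) → Inf (λ j → α j ≡ 1b) → ¬ BoundedCliqueWidth (𝒢 α)
lemma2 α inf (c , bounded) =
  infinitely-many-ones inf (suc c) λ (M , p , one , decr) →
  let T = suc (M * c)
      -- The least number of rows that `grid-not-constructible` admits.
      n = suc (T + (T + T))
      G = grid α n (suc M)
  in constructible⇒¬¬cliqueWidth G
       (finite⇒constructible G (↔-sym *↔×) (λ u v → adj? α _ _))
       λ (k , width) →
         let k≤c = bounded G (grid-𝒢 α n (suc M)) k width
         in grid-not-constructible α k≤c (s≤s k≤c) p one decr ≤-refl (proj₁ width)
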